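{- Let $\Gamma=\forall x\forall y:\phi(x,y)\wedge\bigwedge_{k\in[m]}\forall x\exists y:\beta_k(x,y)$ be an $\mathbf{FO}^2$ sentence in Scott normal form and $\Delta=\{e_1,\dots,e_n\}$ a finite non-empty domain. Fix a pair $(i,j)$. Let $C$ and $C'$ be the circuits returned by the calls $\textsc{Stage-II}((i,j),\theta)$ and $\textsc{Stage-II}((i,j),\theta')$ of the Two-Stage Compilation algorithm (described in the context), respectively. If - $S_\theta=S_{\theta'}$; and - for any unprocessed pair of elements $(e_\ell,e_t)$, $\mathcal B(\tau_\ell,\tau_t)=\mathcal B(\tau'_\ell,\tau'_t)$, where $\tau_\ell,\tau_t$ (resp. $\tau'_\ell,\tau'_t$) are the unary types of $e_\ell,e_t$ in $\theta$ (resp. in $\theta'$), then $C$ and $C'$ are equivalent (have the same satisfying assignments).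
   Context: Logic. First-order logic is function-free, constant-free and without equality. Vocabularies are finite, with predicates of arity 1 or 2. In the Scott normal form, $\phi$ is quantifier-free with variables among $x,y$ and each $\beta_k(x,y)$ is a single binary atom. Ground atoms over $\Delta$ are the propositional variables. Circuits. An NNF circuit is a labelled DAG with internal nodes $\wedge,\vee$, leaves that are literals (or the constants $\top,\bot$), and a unique output node. Types. A unary type $\tau$ is a maximally consistent set of literals over the atoms $P(x)$ ($P$ unary in $\Gamma$) and $R(x,x)$ ($R$ binary in $\Gamma$). A binary type $\pi$ is a maximally consistent set of literals over the atoms $R(x,y),R(y,x)$ ($R$ binary in $\Gamma$). Types are identified with the conjunctions $\tau(x)$, $\pi(x,y)$ of their literals. $\tau$ is valid if $\tau(x)\models\phi(x,x)$; $\mathcal U$ is the set of valid unary types. For $\tau,\tau'\in\mathcal U$, $\mathcal B(\tau,\tau')$ is the set of binary types $\pi$ with $\tau(x)\wedge\tau'(y)\wedge\pi(x,y)\models\phi(x,y)\wedge\phi(y,x)$. Algorithm. A context $\theta$ is the conjunction of the ground type formulas chosen so far along the current recursion branch. $\textsc{Extendable}(\theta)$ holds iff there is a model $\mathcal A$ over $\Delta$ with $\mathcal A\models\Gamma\wedge\theta$. $\textsc{Or}(S)$ and $\textsc{And}(S)$ create an $\vee$-node (resp. $\wedge$-node) with children $S$; empty $\textsc{Or}$ is $\bot$ and empty $\textsc{And}$ is $\top$. Two-Stage Compilation returns $\textsc{Stage-I}(1,\top)$, where: - $\textsc{Stage-I}(i,\theta)$: if $i=n+1$, return $\textsc{Stage-II}((1,2),\theta)$.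 Otherwise return $\textsc{Or}$ of the set of all nodes $\textsc{And}(\textsc{And}(\tau(e_i)),\textsc{Stage-I}(i+1,\theta\wedge\tau(e_i)))$, over all $\tau\in\mathcal U$ for which $\textsc{Extendable}(\theta\wedge\tau(e_i))$ holds, where $\textsc{And}(\tau(e_i))$ is the $\wedge$-node over the literals of $\tau(e_i)$. - $\textsc{Stage-II}((i,j),\theta)$: if $i=n$, return $\top$. Otherwise let $\tau_i,\tau_j$ be the unary types assigned to $e_i,e_j$ in $\theta$ and return $\textsc{Or}$ of the set of all nodes $\textsc{And}(\textsc{And}(\pi(e_i,e_j)),\textsc{Stage-II}(\mathrm{next}(i,j),\theta\wedge\pi(e_i,e_j)))$, over all $\pi\in\mathcal B(\tau_i,\tau_j)$ for which $\textsc{Extendable}(\theta\wedge\pi(e_i,e_j))$ holds. Here $\mathrm{next}(i,j)=(i,j+1)$ if $j<n$ and $(i+1,i+2)$ if $j=n$. Recursive calls are made only for contexts passing the $\textsc{Extendable}$ test. Thus the context $\theta$ of a call $\textsc{Stage-II}((i,j),\theta)$ assigns a valid unary type to every element of $\Delta$, and a valid binary type to every pair $(e_\ell,e_t)$, $\ell<t$, with $(\ell,t)$ lexicographically smaller than $(i,j)$. The unprocessed pairs are the pairs $(e_\ell,e_t)$, $\ell<t$, with $(\ell,t)$ lexicographically at least $(i,j)$. Satisfaction state. $S_\theta$ is the $n\times m$ Boolean matrix with $S_\theta(\ell,k)=\mathrm{True}$ iff there exists $e_t\in\Delta$ (possibly $t=\ell$) with $\theta\models\beta_k(e_\ell,e_t)$.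 -}

module Defs where

open import Data.Bool using (Bool; true; false; not; _∧_; _∨_)
import Data.Bool.Properties as Bool
open import Data.Empty as Empty using (⊥-elim)
open import Data.Fin using (Fin; zero; suc; toℕ; fromℕ<; inject≤; combine; remQuot; splitAt; _↑ˡ_; _↑ʳ_)
  renaming (_<_ to _<ᶠ_; _≤_ to _≤ᶠ_)
import Data.Fin.Properties as Fin
open import Data.Fin.Subset using (Subset)
open import Data.Fin.Subset.Properties using (anySubset?)
open import Data.List using (List; []; _∷_; _++_; map; concatMap; allFin; filter; cartesianProductWith)
open import Data.List.Relation.Unary.All as All using (All)
import Data.List.Relation.Unary.All.Properties as All
open import Data.List.Relation.Unary.Any using (Any)
open import Data.Nat using (ℕ; zero; suc; _+_; _*_; _≤_; _<_; _<?_; z≤n; s≤s)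
import Data.Nat.Properties as ℕ
open import Data.Product using (∃; _×_; _,_; uncurry)
open import Data.Product.Relation.Binary.Lex.Strict using (×-Lex)
open import Data.Sum using ([_,_]′)
open import Data.Vec using (Vec; []; _∷_; _∷ʳ_; lookup; tabulate)
import Data.Vec.Properties as Vec
open import Function using (_∘_)
open import Function.Bundles using (_⇔_)
open import Relation.Binary.PropositionalEquality
  using (_≡_; refl; sym; trans; cong; cong₂; subst; _≗_)
open import Relation.Nullary using (¬_; Dec; yes; no; does)
open import Relation.Nullary.Decidable using (_×-dec_; ¬?; map′)
open import Relation.Unary using (Pred; Decidable)

record Vocabulary : Set where
  field
    #unary  : ℕ
    #binary : ℕ

open Vocabulary

data Atom (𝒱 : Vocabulary) (D : Set) : Set where
  unary  : Fin (#unary 𝒱) → D → Atom 𝒱 D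
  binary : Fin (#binary 𝒱) → D → D → Atom 𝒱 D

-- A structure with domain D is given by the truth values of its atoms.
-- For D = Fin n this is at the same time an assignment to the ground atoms
-- over Δ, which are the propositional variables of the circuits.
Structure : Vocabulary → Set → Set
Structure 𝒱 D = Atom 𝒱 D → Bool

data Var : Set where
  x y : Var

⟨_,_⟩ : {D : Set} → D → D → Var → D
⟨ a , b ⟩ x = a
⟨ a , b ⟩ y = b

infixr 6 _`∧_
infixr 5 _`∨_
infixr 4 _`⇒_

data Formula (𝒱 : Vocabulary) : Set where
  atom           : Atom 𝒱 Var → Formula 𝒱
  `⊤ `⊥          : Formula 𝒱
  `¬_            : Formula 𝒱 → Formula 𝒱
  _`∧_ _`∨_ _`⇒_ : Formula 𝒱 → Formula 𝒱 → Formula 𝒱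

instantiate : ∀ {𝒱} {D : Set} → (Var → D) → Atom 𝒱 Var → Atom 𝒱 D
instantiate ρ (unary P s)    = unary P (ρ s)
instantiate ρ (binary R s t) = binary R (ρ s) (ρ t)

⟦_⟧ : ∀ {𝒱} {D : Set} → Formula 𝒱 → Structure 𝒱 D → (Var → D) → Bool
⟦ atom α ⟧ A ρ = A (instantiate ρ α)
⟦ `⊤ ⟧     A ρ = true
⟦ `⊥ ⟧     A ρ = false
⟦ `¬ φ ⟧   A ρ = not (⟦ φ ⟧ A ρ)
⟦ φ `∧ ψ ⟧ A ρ = ⟦ φ ⟧ A ρ ∧ ⟦ ψ ⟧ A ρ
⟦ φ `∨ ψ ⟧ A ρ = ⟦ φ ⟧ A ρ ∨ ⟦ ψ ⟧ A ρ
⟦ φ `⇒ ψ ⟧ A ρ = not (⟦ φ ⟧ A ρ) ∨ ⟦ ψ ⟧ A ρ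

_⊨_[_,_] : ∀ {𝒱} {D : Set} → Structure 𝒱 D → Formula 𝒱 → D → D → Set
A ⊨ φ [ a , b ] = ⟦ φ ⟧ A ⟨ a , b ⟩ ≡ true

-- R(x,y), R(y,x), R(x,x) or R(y,y).
record BinaryAtom (𝒱 : Vocabulary) : Set where
  field
    predicate : Fin (#binary 𝒱)
    arg₁ arg₂ : Var

_at[_,_] : ∀ {𝒱} {D : Set} → BinaryAtom 𝒱 → D → D → Atom 𝒱 D
β at[ a , b ] = instantiate ⟨ a , b ⟩ (binary predicate arg₁ arg₂)
  where open BinaryAtom β

-- ∀x∀y: φ(x,y) ∧ ⋀ₖ ∀x∃y: βₖ(x,y)
record ScottSentence (𝒱 : Vocabulary) : Set where
  field
    φ : Formula 𝒱
    m : ℕ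
    β : Fin m → BinaryAtom 𝒱

_⊨ᵍ_ : ∀ {𝒱} {D : Set} → Structure 𝒱 D → ScottSentence 𝒱 → Set
A ⊨ᵍ Γ = (∀ a b → A ⊨ φ [ a , b ]) × (∀ k a → ∃ λ b → A (β k at[ a , b ]) ≡ true)
  where open ScottSentence Γ

record Literal (𝒱 : Vocabulary) (D : Set) : Set where
  constructor literal
  field
    sign  : Bool
    lAtom : Atom 𝒱 D

open Literal public

_⊨ˡ_ : ∀ {𝒱} {D : Set} → Structure 𝒱 D → Literal 𝒱 D → Set
A ⊨ˡ l = A (lAtom l) ≡ sign l

_⊨ᶜ_ : ∀ {𝒱} {D : Set} → Structure 𝒱 D → List (Literal 𝒱 D) → Set
A ⊨ᶜ ls = All (A ⊨ˡ_) ls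

-- The nodes made by And and Or are always fresh, so every circuit built from
-- them is a tree.
data Circuit (𝒱 : Vocabulary) (D : Set) : Set where
  lit : Literal 𝒱 D → Circuit 𝒱 D
  ⊤ ⊥ : Circuit 𝒱 D
  ⋀ ⋁ : List (Circuit 𝒱 D) → Circuit 𝒱 D

data _⊩_ {𝒱 : Vocabulary} {D : Set} (ω : Structure 𝒱 D) : Circuit 𝒱 D → Set where
  lit : ∀ {l} → ω ⊨ˡ l → ω ⊩ lit l
  ⊤   : ω ⊩ ⊤
  ⋀   : ∀ {cs} → All (ω ⊩_) cs → ω ⊩ ⋀ cs
  ⋁   : ∀ {cs} → Any (ω ⊩_) cs → ω ⊩ ⋁ cs

Equivalent : ∀ {𝒱} {D : Set} → Circuit 𝒱 D → Circuit 𝒱 D → Set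
Equivalent C C′ = ∀ ω → ω ⊩ C ⇔ ω ⊩ C′

And : ∀ {𝒱} {D : Set} → List (Circuit 𝒱 D) → Circuit 𝒱 D
And []       = ⊤
And (c ∷ cs) = ⋀ (c ∷ cs)

Or : ∀ {𝒱} {D : Set} → List (Circuit 𝒱 D) → Circuit 𝒱 D
Or []       = ⊥
Or (c ∷ cs) = ⋁ (c ∷ cs)

-- A maximally consistent set of literals over finitely many atoms is a choice
-- of one sign per atom: P(x) and R(x,x) for unary types, R(x,y) and R(y,x)
-- for binary types.
record UnaryType (𝒱 : Vocabulary) : Set where
  constructor unaryType
  field
    signP   : Vec Bool (#unary 𝒱)
    signRxx : Vec Bool (#binary 𝒱)

record BinaryType (𝒱 : Vocabulary) : Set where
  constructor binaryType
  field
    signRxy : Vec Bool (#binary 𝒱)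
    signRyx : Vec Bool (#binary 𝒱)

_⟨_⟩₁ : ∀ {𝒱} {D : Set} → UnaryType 𝒱 → D → List (Literal 𝒱 D)
_⟨_⟩₁ {𝒱} τ a =
  map (λ P → literal (lookup signP P) (unary P a)) (allFin (#unary 𝒱)) ++
  map (λ R → literal (lookup signRxx R) (binary R a a)) (allFin (#binary 𝒱))
  where open UnaryType τ

_⟨_,_⟩₂ : ∀ {𝒱} {D : Set} → BinaryType 𝒱 → D → D → List (Literal 𝒱 D)
_⟨_,_⟩₂ {𝒱} π a b =
  map (λ R → literal (lookup signRxy R) (binary R a b)) (allFin (#binary 𝒱)) ++
  map (λ R → literal (lookup signRyx R) (binary R b a)) (allFin (#binary 𝒱))
  where open BinaryType π

allSigns : ∀ k → List (Vec Bool k)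
allSigns zero    = [] ∷ []
allSigns (suc k) = cartesianProductWith _∷_ (false ∷ true ∷ []) (allSigns k)

allBinaryTypes : ∀ 𝒱 → List (BinaryType 𝒱)
allBinaryTypes 𝒱 = cartesianProductWith binaryType (allSigns (#binary 𝒱)) (allSigns (#binary 𝒱))

module _ {𝒱 : Vocabulary} (Γ : ScottSentence 𝒱) where
  open ScottSentence Γ

  -- Entailment between open formulas quantifies over all structures and all
  -- values of the free variables.
  𝓤 : Pred (UnaryType 𝒱) _
  𝓤 τ = (D : Set) (A : Structure 𝒱 D) (a : D) → A ⊨ᶜ (τ ⟨ a ⟩₁) → A ⊨ φ [ a , a ]

  𝓑 : UnaryType 𝒱 → UnaryType 𝒱 → Pred (BinaryType 𝒱) _
  𝓑 τ τ′ π = (D : Set) (A : Structure 𝒱 D) (a b : D) →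
    A ⊨ᶜ (τ ⟨ a ⟩₁ ++ τ′ ⟨ b ⟩₁ ++ π ⟨ a , b ⟩₂) → A ⊨ φ [ a , b ] × A ⊨ φ [ b , a ]

-- The argument (i,j) of a Stage-II call; end is the pair (n,n+1) with which
-- the recursion stops.
data Position (n : ℕ) : Set where
  pair : (i j : Fin n) → i <ᶠ j → Position n
  end  : Position n

first : ∀ n → Position n
first zero          = end
first (suc zero)    = end
first (suc (suc n)) = pair zero (suc zero) (s≤s z≤n)

next : ∀ {n} (i j : Fin n) → i <ᶠ j → Position n
next {n} i j i<j with suc (toℕ j) <? n
... | yes j+1<n = pair i (fromℕ< j+1<n)
        (subst (toℕ i <_) (sym (Fin.toℕ-fromℕ< j+1<n)) (ℕ.m<n⇒m<1+n i<j))
... | no _ with suc (suc (toℕ i)) <? n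
...   | yes i+2<n = pair (fromℕ< i+1<n) (fromℕ< i+2<n)
          (subst (_≤ toℕ (fromℕ< i+2<n)) (cong suc (sym (Fin.toℕ-fromℕ< i+1<n)))
            (ℕ.≤-reflexive (sym (Fin.toℕ-fromℕ< i+2<n))))
        where i+1<n = ℕ.<-trans (ℕ.n<1+n _) i+2<n
...   | no _ = end

Unprocessed : ∀ {n} → Position n → Fin n → Fin n → Set
Unprocessed (pair i j _) ℓ t = ℓ <ᶠ t × ×-Lex _≡_ _<ᶠ_ _≤ᶠ_ (i , j) (ℓ , t)
Unprocessed end          ℓ t = Empty.⊥

data Terminates {n : ℕ} : Position n → Set where
  stop : Terminates end
  step : ∀ {i j i<j} → Terminates (next i j i<j) → Terminates (pair i j i<j)

next-elim : ∀ {n} (P : Position n → Set) (i j : Fin n) (i<j : i <ᶠ j) →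
            (∀ j′ i<j′ → toℕ j′ ≡ suc (toℕ j) → P (pair i j′ i<j′)) →
            (∀ i′ j′ i′<j′ → toℕ i′ ≡ suc (toℕ i) → P (pair i′ j′ i′<j′)) →
            P end → P (next i j i<j)
next-elim {n} P i j i<j row rows last with suc (toℕ j) <? n
... | yes j+1<n = row _ _ (Fin.toℕ-fromℕ< j+1<n)
... | no _ with suc (suc (toℕ i)) <? n
...   | yes i+2<n = rows _ _ _ (Fin.toℕ-fromℕ< _)
...   | no _ = last

terminates : ∀ {n} (p : Position n) → Terminates p
terminates end = stop
terminates {n} (pair i j i<j) =
  from n n i j i<j (ℕ.m≤n+m n (toℕ i)) (ℕ.m≤n+m n (toℕ j))
  where
  shift : ∀ {i i′ f} → i′ ≡ suc i → n ≤ i + suc f → n ≤ i′ + f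
  shift refl n≤ = subst (n ≤_) (ℕ.+-suc _ _) n≤

  absurd : ∀ (i : Fin n) → ¬ (n ≤ toℕ i + 0)
  absurd i n≤ = ℕ.<⇒≱ (Fin.toℕ<n i) (subst (n ≤_) (ℕ.+-identityʳ _) n≤)

  from : ∀ fᵢ fⱼ (i j : Fin n) (i<j : i <ᶠ j) →
         n ≤ toℕ i + fᵢ → n ≤ toℕ j + fⱼ → Terminates (pair i j i<j)
  from zero     fⱼ       i j i<j n≤ᵢ n≤ⱼ = ⊥-elim (absurd i n≤ᵢ)
  from (suc fᵢ) zero     i j i<j n≤ᵢ n≤ⱼ = ⊥-elim (absurd j n≤ⱼ)
  from (suc fᵢ) (suc fⱼ) i j i<j n≤ᵢ n≤ⱼ = step (next-elim Terminates i j i<j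
    (λ j′ i<j′ eq → from (suc fᵢ) fⱼ i j′ i<j′ n≤ᵢ (shift eq n≤ⱼ))
    (λ i′ j′ i′<j′ eq → from fᵢ n i′ j′ i′<j′ (shift eq n≤ᵢ) (ℕ.m≤n+m n (toℕ j′)))
    stop)

⟦⟧-cong : ∀ {𝒱} {D E : Set} (φ : Formula 𝒱) {A : Structure 𝒱 D} {B : Structure 𝒱 E} {ρ σ} →
          A ∘ instantiate ρ ≗ B ∘ instantiate σ → ⟦ φ ⟧ A ρ ≡ ⟦ φ ⟧ B σ
⟦⟧-cong (atom α) A≗B = A≗B α
⟦⟧-cong `⊤       A≗B = refl
⟦⟧-cong `⊥       A≗B = refl
⟦⟧-cong (`¬ φ)   A≗B = cong not (⟦⟧-cong φ A≗B)
⟦⟧-cong (φ `∧ ψ) A≗B = cong₂ _∧_ (⟦⟧-cong φ A≗B) (⟦⟧-cong ψ A≗B)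
⟦⟧-cong (φ `∨ ψ) A≗B = cong₂ _∨_ (⟦⟧-cong φ A≗B) (⟦⟧-cong ψ A≗B)
⟦⟧-cong (φ `⇒ ψ) A≗B = cong₂ _∨_ (cong not (⟦⟧-cong φ A≗B)) (⟦⟧-cong ψ A≗B)

_⊨ᶜ?_ : ∀ {𝒱} {D : Set} (A : Structure 𝒱 D) ls → Dec (A ⊨ᶜ ls)
A ⊨ᶜ? ls = All.all? (λ l → A (lAtom l) Bool.≟ sign l) ls

⊨ᶜ-resp : ∀ {𝒱} {D : Set} {A B : Structure 𝒱 D} {ls} → A ≗ B → A ⊨ᶜ ls → B ⊨ᶜ ls
⊨ᶜ-resp A≗B = All.map (λ {l} eq → trans (sym (A≗B (lAtom l))) eq)

_⊨ᵍ?_ : ∀ {𝒱 n} (A : Structure 𝒱 (Fin n)) Γ → Dec (A ⊨ᵍ Γ)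
A ⊨ᵍ? Γ =
  Fin.all? (λ a → Fin.all? λ b → ⟦ φ ⟧ A ⟨ a , b ⟩ Bool.≟ true) ×-dec
  Fin.all? (λ k → Fin.all? λ a → Fin.any? λ b → A (β k at[ a , b ]) Bool.≟ true)
  where open ScottSentence Γ

⊨ᵍ-resp : ∀ {𝒱} {D : Set} Γ {A B : Structure 𝒱 D} → A ≗ B → A ⊨ᵍ Γ → B ⊨ᵍ Γ
⊨ᵍ-resp Γ A≗B (∀∀φ , ∀∃β) =
  (λ a b → trans (sym (⟦⟧-cong φ (λ α → A≗B (instantiate ⟨ a , b ⟩ α)))) (∀∀φ a b)) ,
  (λ k a → let b , eq = ∀∃β k a in b , trans (sym (A≗B (β k at[ a , b ]))) eq)
  where open ScottSentence Γ

anyStructure? : ∀ {𝒱 n} {P : Structure 𝒱 (Fin n) → Set} → Decidable P →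
                (∀ {A B} → A ≗ B → P A → P B) → Dec (∃ P)
anyStructure? {𝒱} {n} P? resp =
  map′ (λ (s , p) → decode s , p) (λ (A , p) → encode A , resp (sym ∘ decode-encode A) p)
       (anySubset? (P? ∘ decode))
  where
  u = #unary 𝒱 * n
  b = #binary 𝒱 * (n * n)

  index : Atom 𝒱 (Fin n) → Fin (u + b)
  index (unary P a)    = combine P a ↑ˡ b
  index (binary R a c) = u ↑ʳ combine R (combine a c)

  unindex : Fin (u + b) → Atom 𝒱 (Fin n)
  unindex = [ uncurry unary ∘ remQuot n
            , uncurry (λ R → uncurry (binary R) ∘ remQuot n) ∘ remQuot (n * n)
            ]′ ∘ splitAt u

  unindex-index : ∀ α → unindex (index α) ≡ α
  unindex-index (unary P a)
    rewrite Fin.splitAt-↑ˡ u (combine P a) b = cong (uncurry unary) (Fin.remQuot-combine P a)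
  unindex-index (binary R a c)
    rewrite Fin.splitAt-↑ʳ u b (combine R (combine a c)) =
    trans (cong (uncurry λ R → uncurry (binary R) ∘ remQuot n) (Fin.remQuot-combine R (combine a c)))
          (cong (uncurry (binary R)) (Fin.remQuot-combine a c))

  decode : Subset (u + b) → Structure 𝒱 (Fin n)
  decode s α = lookup s (index α)

  encode : Structure 𝒱 (Fin n) → Subset (u + b)
  encode A = tabulate (A ∘ unindex)

  decode-encode : ∀ A → decode (encode A) ≗ A
  decode-encode A α = trans (Vec.lookup∘tabulate (A ∘ unindex) (index α)) (cong A (unindex-index α))

module _ {𝒱 : Vocabulary} {D : Set} {A : Structure 𝒱 D} where

  open UnaryType
  open BinaryType

  ⊨₁⁺ : ∀ (τ : UnaryType 𝒱) {a} →
        (∀ P → A (unary P a) ≡ lookup (signP τ) P) →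
        (∀ R → A (binary R a a) ≡ lookup (signRxx τ) R) → A ⊨ᶜ (τ ⟨ a ⟩₁)
  ⊨₁⁺ τ p r = All.++⁺ (All.map⁺ (All.tabulate⁺ p)) (All.map⁺ (All.tabulate⁺ r))

  ⊨₁⁻ : ∀ (τ : UnaryType 𝒱) {a} → A ⊨ᶜ (τ ⟨ a ⟩₁) →
        (∀ P → A (unary P a) ≡ lookup (signP τ) P) × (∀ R → A (binary R a a) ≡ lookup (signRxx τ) R)
  ⊨₁⁻ τ h with All.++⁻ (map _ (allFin (#unary 𝒱))) h
  ... | p , r = All.tabulate⁻ (All.map⁻ p) , All.tabulate⁻ (All.map⁻ r)

  ⊨₂⁺ : ∀ (π : BinaryType 𝒱) {a b} →
        (∀ R → A (binary R a b) ≡ lookup (signRxy π) R) →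
        (∀ R → A (binary R b a) ≡ lookup (signRyx π) R) → A ⊨ᶜ (π ⟨ a , b ⟩₂)
  ⊨₂⁺ π r r′ = All.++⁺ (All.map⁺ (All.tabulate⁺ r)) (All.map⁺ (All.tabulate⁺ r′))

  ⊨₂⁻ : ∀ (π : BinaryType 𝒱) {a b} → A ⊨ᶜ (π ⟨ a , b ⟩₂) →
        (∀ R → A (binary R a b) ≡ lookup (signRxy π) R) × (∀ R → A (binary R b a) ≡ lookup (signRyx π) R)
  ⊨₂⁻ π h with All.++⁻ (map _ (allFin (#binary 𝒱))) h
  ... | r , r′ = All.tabulate⁻ (All.map⁻ r) , All.tabulate⁻ (All.map⁻ r′)

module _ {𝒱 : Vocabulary} (Γ : ScottSentence 𝒱) (τ τ′ : UnaryType 𝒱) (π : BinaryType 𝒱) where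
  open ScottSentence Γ
  open UnaryType
  open BinaryType

  -- The structure with domain {x,y} in which x has type τ, y has type τ′ and
  -- (x,y) has type π.
  canonical : Structure 𝒱 Var
  canonical (unary P x)    = lookup (signP τ) P
  canonical (unary P y)    = lookup (signP τ′) P
  canonical (binary R x x) = lookup (signRxx τ) R
  canonical (binary R y y) = lookup (signRxx τ′) R
  canonical (binary R x y) = lookup (signRxy π) R
  canonical (binary R y x) = lookup (signRyx π) R

  private
    lits : ∀ {D : Set} → D → D → List (Literal 𝒱 D)
    lits a b = τ ⟨ a ⟩₁ ++ τ′ ⟨ b ⟩₁ ++ π ⟨ a , b ⟩₂

    canonical-⊨ : canonical ⊨ᶜ lits x y
    canonical-⊨ = All.++⁺ (⊨₁⁺ τ (λ _ → refl) (λ _ → refl)) (All.++⁺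
      (⊨₁⁺ τ′ (λ _ → refl) (λ _ → refl)) (⊨₂⁺ π (λ _ → refl) (λ _ → refl)))

    module _ {D : Set} {A : Structure 𝒱 D} {a b : D} (A⊨ : A ⊨ᶜ lits a b) where

      agrees : ∀ α → A (instantiate ⟨ a , b ⟩ α) ≡ canonical α
      agrees α with All.++⁻ (τ ⟨ a ⟩₁) A⊨
      ... | A⊨τ , A⊨τ′π with All.++⁻ (τ′ ⟨ b ⟩₁) A⊨τ′π
      ... | A⊨τ′ , A⊨π with ⊨₁⁻ τ A⊨τ | ⊨₁⁻ τ′ A⊨τ′ | ⊨₂⁻ π A⊨π
      ... | px , rxx | py , ryy | rxy , ryx = go α
        where
        go : ∀ α → A (instantiate ⟨ a , b ⟩ α) ≡ canonical α
        go (unary P x)    = px P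
        go (unary P y)    = py P
        go (binary R x x) = rxx R
        go (binary R y y) = ryy R
        go (binary R x y) = rxy R
        go (binary R y x) = ryx R

      agrees-xy : A ∘ instantiate ⟨ a , b ⟩ ≗ canonical ∘ instantiate ⟨ x , y ⟩
      agrees-xy α = trans (agrees α) (cong canonical (sym (instantiate-xy α)))
        where
        ⟨x,y⟩-id : ∀ v → ⟨ x , y ⟩ v ≡ v
        ⟨x,y⟩-id x = refl
        ⟨x,y⟩-id y = refl

        instantiate-xy : ∀ α → instantiate ⟨ x , y ⟩ α ≡ α
        instantiate-xy (unary P s)    = cong (unary P) (⟨x,y⟩-id s)
        instantiate-xy (binary R s t) = cong₂ (binary R) (⟨x,y⟩-id s) (⟨x,y⟩-id t)

      agrees-yx : A ∘ instantiate ⟨ b , a ⟩ ≗ canonical ∘ instantiate ⟨ y , x ⟩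
      agrees-yx α = trans (cong A (swap α)) (agrees (instantiate ⟨ y , x ⟩ α))
        where
        swapᵛ : ∀ v → ⟨ b , a ⟩ v ≡ ⟨ a , b ⟩ (⟨ y , x ⟩ v)
        swapᵛ x = refl
        swapᵛ y = refl

        swap : ∀ α → instantiate ⟨ b , a ⟩ α ≡ instantiate ⟨ a , b ⟩ (instantiate ⟨ y , x ⟩ α)
        swap (unary P s)    = cong (unary P) (swapᵛ s)
        swap (binary R s t) = cong₂ (binary R) (swapᵛ s) (swapᵛ t)

  𝓑? : Dec (𝓑 Γ τ τ′ π)
  𝓑? = map′
    (λ (φxy , φyx) D A a b A⊨ → trans (⟦⟧-cong φ (agrees-xy A⊨)) φxy ,
                                trans (⟦⟧-cong φ (agrees-yx A⊨)) φyx)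
    (λ ⊨φ → ⊨φ Var canonical x y canonical-⊨)
    ((⟦ φ ⟧ canonical ⟨ x , y ⟩ Bool.≟ true) ×-dec (⟦ φ ⟧ canonical ⟨ y , x ⟩ Bool.≟ true))

-- Two-Stage Compilation over the domain Δ = Fin n.
module Compilation {𝒱 : Vocabulary} (Γ : ScottSentence 𝒱) (n : ℕ) where
  open ScottSentence Γ

  -- The unary types chosen for the first k elements, followed by the binary
  -- types chosen for pairs of elements.
  record Context (k : ℕ) : Set where
    constructor context
    field
      k≤n         : k ≤ n
      unaryTypes  : Vec (UnaryType 𝒱) k
      binaryTypes : List (BinaryType 𝒱 × Fin n × Fin n)

  open Context

  conj : ∀ {k} → Context k → List (Literal 𝒱 (Fin n))
  conj {k} (context k≤n τs πs) =
    concatMap (λ ℓ → lookup τs ℓ ⟨ inject≤ ℓ k≤n ⟩₁) (allFin k) ++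
    concatMap (λ (π , ℓ , t) → π ⟨ ℓ , t ⟩₂) πs

  ∅ : Context 0
  ∅ = context z≤n [] []

  -- θ ∧ τ(e), where e is the first element without a type in θ
  addUnary : ∀ {k} → k < n → Context k → UnaryType 𝒱 → Context (suc k)
  addUnary k<n (context _ τs πs) τ = context k<n (τs ∷ʳ τ) πs

  addBinary : ∀ {k} → Context k → BinaryType 𝒱 → Fin n → Fin n → Context k
  addBinary (context k≤n τs πs) π i j = context k≤n τs ((π , i , j) ∷ πs)

  type : Context n → Fin n → UnaryType 𝒱
  type θ ℓ = lookup (unaryTypes θ) ℓ

  Extendable : ∀ {k} → Context k → Set
  Extendable θ = ∃ λ (A : Structure 𝒱 (Fin n)) → A ⊨ᵍ Γ × A ⊨ᶜ conj θ

  extendable? : ∀ {k} (θ : Context k) → Dec (Extendable θ)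
  extendable? θ = anyStructure? (λ A → (A ⊨ᵍ? Γ) ×-dec (A ⊨ᶜ? conj θ))
    (λ A≗B (A⊨Γ , A⊨θ) → ⊨ᵍ-resp Γ A≗B A⊨Γ , ⊨ᶜ-resp A≗B A⊨θ)

  Stage-II′ : ∀ {p : Position n} → Terminates p → Context n → Circuit 𝒱 (Fin n)
  Stage-II′ stop θ = ⊤
  Stage-II′ (step {i} {j} r) θ = Or (map node
    (filter (λ π → extendable? (addBinary θ π i j))
    (filter (𝓑? Γ (type θ i) (type θ j)) (allBinaryTypes 𝒱))))
    where
    node : BinaryType 𝒱 → Circuit 𝒱 (Fin n)
    node π = And (And (map lit (π ⟨ i , j ⟩₂)) ∷ Stage-II′ r (addBinary θ π i j) ∷ [])

  Stage-II : Position n → Context n → Circuit 𝒱 (Fin n)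
  Stage-II p = Stage-II′ (terminates p)

  -- The calls made by the algorithm: Stage-I-Call {k} θ is the call in which
  -- the first k elements have already been assigned a type.
  data Stage-I-Call : ∀ {k} → Context k → Set₁ where
    initial : Stage-I-Call ∅
    recurse : ∀ {k} {θ : Context k} {τ} (k<n : k < n) →
              Stage-I-Call θ → 𝓤 Γ τ → Extendable (addUnary k<n θ τ) →
              Stage-I-Call (addUnary k<n θ τ)

  data Stage-II-Call : Position n → Context n → Set₁ where
    initial : ∀ {θ} → Stage-I-Call θ → Stage-II-Call (first n) θ
    recurse : ∀ {i j i<j θ π} →
              Stage-II-Call (pair i j i<j) θ →
              𝓑 Γ (type θ i) (type θ j) π → Extendable (addBinary θ π i j) →
              Stage-II-Call (next i j i<j) (addBinary θ π i j)

  -- θ and α are ground over Δ, so only the structures with domain Δ matter.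
  Entails : ∀ {k} → Context k → Atom 𝒱 (Fin n) → Set
  Entails θ α = (A : Structure 𝒱 (Fin n)) → A ⊨ᶜ conj θ → A α ≡ true

  entails? : ∀ {k} (θ : Context k) α → Dec (Entails θ α)
  entails? θ α = map′
    (λ ∄A A A⊨θ → Bool.¬-not λ eq → ∄A (A , A⊨θ , eq))
    (λ θ⊨α (A , A⊨θ , eq) → Bool.not-¬ (θ⊨α A A⊨θ) eq)
    (¬? (anyStructure? (λ A → (A ⊨ᶜ? conj θ) ×-dec (A α Bool.≟ false))
      (λ A≗B (A⊨θ , eq) → ⊨ᶜ-resp A≗B A⊨θ , trans (sym (A≗B α)) eq)))

  S : Context n → Vec (Vec Bool m) n
  S θ = tabulate λ ℓ → tabulate λ k → does (Fin.any? λ t → entails? θ (β k at[ ℓ , t ]))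

{-# OPTIONS --safe #-}
module Submission where

-- Stage-II((i,j),θ) accepts ω iff Γ ∧ θ has a model agreeing with ω on the atoms
-- of the unprocessed pairs.  Given such a model A for θ, and any model A′ of
-- Γ ∧ θ′, the structure that follows A on the unprocessed pairs and A′ elsewhere
-- is again a model of Γ ∧ θ′: φ holds on unprocessed pairs because the sets 𝓑
-- agree, and a witness for βₖ in A either lies on an unprocessed pair, or is
-- fixed by θ and hence recorded in S θ = S θ′.

open import Data.Bool using (Bool; true; false; if_then_else_)
open import Data.Empty as Empty using (⊥-elim)
open import Data.Fin using (Fin; zero; suc; toℕ; inject≤) renaming (_<_ to _<ᶠ_)
import Data.Fin.Properties as Fin
open import Data.List using (List; []; _∷_; map; concatMap; allFin; filter)
open import Data.List.Membership.Propositional using (_∈_; find; lose)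
open import Data.List.Membership.Propositional.Properties
  using (∈-cartesianProductWith⁺; ∈-filter⁺; ∈-filter⁻)
open import Data.List.Relation.Unary.All as All using (All; []; _∷_)
import Data.List.Relation.Unary.All.Properties as All
open import Data.List.Relation.Unary.Any using (Any; here; there)
import Data.List.Relation.Unary.Any.Properties as Any
open import Data.Nat using (ℕ; zero; suc; NonZero; _≤_; _<_; _<?_; z≤n; s≤s)
import Data.Nat.Properties as ℕ
open import Data.Product using (∃; _×_; _,_; proj₁; proj₂)
open import Data.Product.Relation.Binary.Lex.Strict using (×-decidable)
open import Data.Sum as Sum using (_⊎_; inj₁; inj₂; [_,_]′)
open import Data.Vec using (Vec; []; _∷_; lookup; tabulate)
open import Data.Vec.Properties using (lookup∘tabulate)
open import Function using (_∘_)
open import Function.Bundles using (_⇔_; mk⇔; module Equivalence)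
open import Relation.Binary.Definitions using (tri<; tri≈; tri>)
open import Relation.Binary.PropositionalEquality
  using (_≡_; refl; sym; trans; cong; subst; _≗_; module ≡-Reasoning)
open import Relation.Nullary using (¬_; Dec; yes; no; does; contradiction)
open import Relation.Nullary.Decidable using (_×-dec_; _⊎-dec_; dec-true)
open import Relation.Unary using (_≐_)
open import Defs

open Vocabulary

private variable
  𝒱 : Vocabulary
  D E : Set
  n : ℕ

-- Satisfaction of the circuits, and exhaustiveness of the list of binary types.

does-true⁻ : ∀ {P : Set} (P? : Dec P) → does P? ≡ true → P
does-true⁻ (yes p) _ = p

⊩Or⇔Any : ∀ {ω : Structure 𝒱 D} cs → ω ⊩ Or cs ⇔ Any (ω ⊩_) cs
⊩Or⇔Any []      = mk⇔ (λ ()) (λ ())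
⊩Or⇔Any (_ ∷ _) = mk⇔ (λ { (⋁ h) → h }) ⋁

⊩And⇔All : ∀ {ω : Structure 𝒱 D} cs → ω ⊩ And cs ⇔ All (ω ⊩_) cs
⊩And⇔All []      = mk⇔ (λ _ → []) (λ _ → ⊤)
⊩And⇔All (_ ∷ _) = mk⇔ (λ { (⋀ h) → h }) ⋀

⊩And-lit⇔⊨ᶜ : ∀ {ω : Structure 𝒱 D} ls → ω ⊩ And (map lit ls) ⇔ ω ⊨ᶜ ls
⊩And-lit⇔⊨ᶜ ls = mk⇔
  (All.map (λ { (lit h) → h }) ∘ All.map⁻ ∘ Equivalence.to (⊩And⇔All (map lit ls)))
  (Equivalence.from (⊩And⇔All (map lit ls)) ∘ All.map⁺ ∘ All.map lit)

∈-allSigns : ∀ {k} (v : Vec Bool k) → v ∈ allSigns k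
∈-allSigns []          = here refl
∈-allSigns (false ∷ v) =
  ∈-cartesianProductWith⁺ _∷_ {xs = false ∷ true ∷ []} (here refl) (∈-allSigns v)
∈-allSigns (true ∷ v) =
  ∈-cartesianProductWith⁺ _∷_ {xs = false ∷ true ∷ []} (there (here refl)) (∈-allSigns v)

∈-allBinaryTypes : (π : BinaryType 𝒱) → π ∈ allBinaryTypes 𝒱
∈-allBinaryTypes (binaryType r r′) =
  ∈-cartesianProductWith⁺ binaryType (∈-allSigns r) (∈-allSigns r′)

-- Types realized in a structure.

binaryTypeOf : Structure 𝒱 D → D → D → BinaryType 𝒱
binaryTypeOf A a b = binaryType (tabulate λ R → A (binary R a b)) (tabulate λ R → A (binary R b a))

-- Two structures appear because the type is read off one of them and needed in another that may
-- agree with it only at this pair.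
⊨-binaryTypeOf : ∀ (A B : Structure 𝒱 D) {a b} →
                 (∀ R → B (binary R a b) ≡ A (binary R a b)) →
                 (∀ R → B (binary R b a) ≡ A (binary R b a)) →
                 B ⊨ᶜ (binaryTypeOf A a b ⟨ a , b ⟩₂)
⊨-binaryTypeOf A B {a} {b} r r′ = ⊨₂⁺ (binaryTypeOf A a b)
  (λ R → trans (r R) (sym (lookup∘tabulate _ R)))
  (λ R → trans (r′ R) (sym (lookup∘tabulate _ R)))

module _ (A : Structure 𝒱 D) (B : Structure 𝒱 E) where

  -- Each atom over `x`, `y` occurs, with a sign, in exactly one of the three types.
  types-determine : ∀ (τ τ′ : UnaryType 𝒱) (π : BinaryType 𝒱) {a b c d} →
    A ⊨ᶜ (τ ⟨ a ⟩₁) → A ⊨ᶜ (τ′ ⟨ b ⟩₁) → A ⊨ᶜ (π ⟨ a , b ⟩₂) →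
    B ⊨ᶜ (τ ⟨ c ⟩₁) → B ⊨ᶜ (τ′ ⟨ d ⟩₁) → B ⊨ᶜ (π ⟨ c , d ⟩₂) →
    A ∘ instantiate ⟨ a , b ⟩ ≗ B ∘ instantiate ⟨ c , d ⟩
  types-determine τ τ′ π Aτ Aτ′ Aπ Bτ Bτ′ Bπ = go
    where
    go : A ∘ instantiate ⟨ _ , _ ⟩ ≗ B ∘ instantiate ⟨ _ , _ ⟩
    go (unary P x)    = trans (proj₁ (⊨₁⁻ τ Aτ) P) (sym (proj₁ (⊨₁⁻ τ Bτ) P))
    go (unary P y)    = trans (proj₁ (⊨₁⁻ τ′ Aτ′) P) (sym (proj₁ (⊨₁⁻ τ′ Bτ′) P))
    go (binary R x x) = trans (proj₂ (⊨₁⁻ τ Aτ) R) (sym (proj₂ (⊨₁⁻ τ Bτ) R))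
    go (binary R y y) = trans (proj₂ (⊨₁⁻ τ′ Aτ′) R) (sym (proj₂ (⊨₁⁻ τ′ Bτ′) R))
    go (binary R x y) = trans (proj₁ (⊨₂⁻ π Aπ) R) (sym (proj₁ (⊨₂⁻ π Bπ) R))
    go (binary R y x) = trans (proj₂ (⊨₂⁻ π Aπ) R) (sym (proj₂ (⊨₂⁻ π Bπ) R))

  instantiate-swap : ∀ a b c d →
    A ∘ instantiate ⟨ a , b ⟩ ≗ B ∘ instantiate ⟨ c , d ⟩ →
    A ∘ instantiate ⟨ b , a ⟩ ≗ B ∘ instantiate ⟨ d , c ⟩
  instantiate-swap _ _ _ _ h (unary P x)    = h (unary P y)
  instantiate-swap _ _ _ _ h (unary P y)    = h (unary P x)
  instantiate-swap _ _ _ _ h (binary R x x) = h (binary R y y)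
  instantiate-swap _ _ _ _ h (binary R x y) = h (binary R y x)
  instantiate-swap _ _ _ _ h (binary R y x) = h (binary R x y)
  instantiate-swap _ _ _ _ h (binary R y y) = h (binary R x x)

-- The types of two elements fix the truth value of φ at them, so membership in
-- 𝓑, which speaks of all structures, follows from a single realization.
realized⇒𝓑 : ∀ (Γ : ScottSentence 𝒱) (A : Structure 𝒱 D) {a b} τ τ′ π → A ⊨ᵍ Γ →
             A ⊨ᶜ (τ ⟨ a ⟩₁) → A ⊨ᶜ (τ′ ⟨ b ⟩₁) → A ⊨ᶜ (π ⟨ a , b ⟩₂) → 𝓑 Γ τ τ′ π
realized⇒𝓑 Γ A {a} {b} τ τ′ π (∀∀φ , _) Aτ Aτ′ Aπ E B c d Bτττ′π =
  trans (⟦⟧-cong φ B≗A) (∀∀φ a b) , trans (⟦⟧-cong φ (instantiate-swap B A c d a b B≗A)) (∀∀φ b a)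
  where
  open ScottSentence Γ
  Bτ = All.++⁻ (τ ⟨ c ⟩₁) Bτττ′π
  Bτ′ = All.++⁻ (τ′ ⟨ d ⟩₁) (proj₂ Bτ)

  B≗A : B ∘ instantiate ⟨ c , d ⟩ ≗ A ∘ instantiate ⟨ a , b ⟩
  B≗A = types-determine B A τ τ′ π (proj₁ Bτ) (proj₁ Bτ′) (proj₂ Bτ′) Aτ Aτ′ Aπ

-- Unprocessed pairs and the lexicographic successor.

unprocessed? : ∀ (p : Position n) ℓ t → Dec (Unprocessed p ℓ t)
unprocessed? (pair i j _) ℓ t =
  (ℓ Fin.<? t) ×-dec ×-decidable Fin._≟_ Fin._<?_ Fin._≤?_ (i , j) (ℓ , t)
unprocessed? end          ℓ t = no λ ()

unprocessed⇒< : ∀ (p : Position n) {ℓ t} → Unprocessed p ℓ t → ℓ <ᶠ t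
unprocessed⇒< (pair _ _ _) = proj₁

first-unprocessed : ∀ {ℓ t : Fin n} → ℓ <ᶠ t → Unprocessed (first n) ℓ t
first-unprocessed {suc zero}    {zero}  {zero}  ()
first-unprocessed {suc (suc n)} {zero}  {suc t} ℓ<t = ℓ<t , inj₂ (refl , s≤s z≤n)
first-unprocessed {suc (suc n)} {suc ℓ} {t}     ℓ<t = ℓ<t , inj₁ (s≤s z≤n)

-- Follows the case distinctions of `next` rather than `next-elim`: the exact new column i+2, and
-- the reason why the recursion ends, both matter here.
unprocessed-next⁻ : ∀ (i j : Fin n) i<j {ℓ t} → Unprocessed (pair i j i<j) ℓ t →
                    (ℓ ≡ i × t ≡ j) ⊎ Unprocessed (next i j i<j) ℓ t
unprocessed-next⁻ {n} i j i<j {ℓ} {t} (ℓ<t , i,j≤ℓ,t) with suc (toℕ j) <? n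
... | yes j+1<n with i,j≤ℓ,t
...   | inj₁ i<ℓ = inj₂ (ℓ<t , inj₁ i<ℓ)
...   | inj₂ (refl , j≤t) with j Fin.≟ t
...     | yes refl = inj₁ (refl , refl)
...     | no j≢t   = inj₂ (ℓ<t , inj₂ (refl ,
            subst (_≤ toℕ t) (sym (Fin.toℕ-fromℕ< j+1<n)) (Fin.≤∧≢⇒< j≤t j≢t)))
unprocessed-next⁻ {n} i j i<j {ℓ} {t} (ℓ<t , i,j≤ℓ,t) | no j+1≮n with i,j≤ℓ,t
... | inj₂ (refl , j≤t) = inj₁ (refl , Fin.≤-antisym t≤j j≤t)
  -- In the last column n ≤ j+1, while t < n.
  where t≤j = ℕ.≤-pred (ℕ.≤-trans (Fin.toℕ<n t) (ℕ.≮⇒≥ j+1≮n))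
... | inj₁ i<ℓ with suc (suc (toℕ i)) <? n
-- A later row would need i < ℓ < t < n, which leaves room for i+2.
...   | no i+2≮n = contradiction (ℕ.≤-<-trans (ℕ.≤-trans (s≤s i<ℓ) ℓ<t) (Fin.toℕ<n t)) i+2≮n
...   | yes i+2<n with ℕ.m≤n⇒m<n∨m≡n i<ℓ
...     | inj₁ i+1<ℓ = inj₂ (ℓ<t , inj₁
            (subst (_< toℕ ℓ) (sym (Fin.toℕ-fromℕ< _)) i+1<ℓ))
-- In row i+1 the condition ℓ < t already says that t is at least i+2, the first column of that row.
...     | inj₂ i+1≡ℓ = inj₂ (ℓ<t , inj₂
            ( Fin.toℕ-injective (trans (Fin.toℕ-fromℕ< _) i+1≡ℓ)
            , subst (_≤ toℕ t) (sym (Fin.toℕ-fromℕ< i+2<n))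
                (subst (λ k → suc k ≤ toℕ t) (sym i+1≡ℓ) ℓ<t)))

-- It suffices that `next` moves one column to the right or one row down, which is what `next-elim`
-- offers.
unprocessed-next⁺ : ∀ (i j : Fin n) i<j {ℓ t} → Unprocessed (next i j i<j) ℓ t →
                    Unprocessed (pair i j i<j) ℓ t × ¬ (ℓ ≡ i × t ≡ j)
unprocessed-next⁺ {n} i j i<j {ℓ} {t} = next-elim
  (λ p → Unprocessed p ℓ t → Unprocessed (pair i j i<j) ℓ t × ¬ (ℓ ≡ i × t ≡ j)) i j i<j
  (λ j′ i<j′ eq → λ
    { (ℓ<t , inj₁ i<ℓ) → (ℓ<t , inj₁ i<ℓ) , λ { (refl , _) → ℕ.<-irrefl refl i<ℓ }
    ; (ℓ<t , inj₂ (refl , j′≤t)) →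
        let j<t = subst (_≤ toℕ t) eq j′≤t
        in (ℓ<t , inj₂ (refl , ℕ.<⇒≤ j<t)) , λ { (_ , refl) → ℕ.<-irrefl refl j<t } })
  (λ i′ j′ i′<j′ eq (ℓ<t , i′,j′≤ℓ,t) →
    let i<i′ = ℕ.≤-reflexive (sym eq)
        i<ℓ  = [ ℕ.<-trans i<i′ , (λ { (refl , _) → i<i′ }) ]′ i′,j′≤ℓ,t
    in (ℓ<t , inj₁ i<ℓ) , λ { (refl , _) → ℕ.<-irrefl refl i<ℓ })
  (λ ())

-- Pending atoms: the ground atoms whose values are still to be chosen.

Pending : Position n → Atom 𝒱 (Fin n) → Set
Pending p (unary _ _)    = Empty.⊥
Pending p (binary _ a b) = Unprocessed p a b ⊎ Unprocessed p b a

pending? : ∀ (p : Position n) (α : Atom 𝒱 (Fin n)) → Dec (Pending p α)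
pending? p (unary _ _)    = no λ ()
pending? p (binary _ a b) = unprocessed? p a b ⊎-dec unprocessed? p b a

pending-next⁻ : ∀ {i j : Fin n} i<j (α : Atom 𝒱 (Fin n)) → Pending (pair i j i<j) α →
                Pending (next i j i<j) α ⊎ ∃ λ R → α ≡ binary R i j ⊎ α ≡ binary R j i
pending-next⁻ {i = i} {j} i<j (binary R a b) (inj₁ u) with unprocessed-next⁻ i j i<j u
... | inj₁ (refl , refl) = inj₂ (R , inj₁ refl)
... | inj₂ u′            = inj₁ (inj₁ u′)
pending-next⁻ {i = i} {j} i<j (binary R a b) (inj₂ u) with unprocessed-next⁻ i j i<j u
... | inj₁ (refl , refl) = inj₂ (R , inj₂ refl)
... | inj₂ u′            = inj₁ (inj₂ u′)

pending-next⁺ : ∀ {i j : Fin n} i<j (α : Atom 𝒱 (Fin n)) →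
                Pending (next i j i<j) α → Pending (pair i j i<j) α
pending-next⁺ i<j (binary R a b) = Sum.map u⁺ u⁺
  where
  u⁺ : ∀ {ℓ t} → Unprocessed (next _ _ i<j) ℓ t → Unprocessed (pair _ _ i<j) ℓ t
  u⁺ = proj₁ ∘ unprocessed-next⁺ _ _ i<j

here-unprocessed : ∀ {i j : Fin n} (i<j : i <ᶠ j) → Unprocessed (pair i j i<j) i j
here-unprocessed i<j = i<j , inj₂ (refl , ℕ.≤-refl)

here-not-pending-next : ∀ {i j : Fin n} i<j →
                        ¬ (Unprocessed (next i j i<j) i j ⊎ Unprocessed (next i j i<j) j i)
here-not-pending-next i<j (inj₁ u) = proj₂ (unprocessed-next⁺ _ _ i<j u) (refl , refl)
here-not-pending-next i<j (inj₂ u) = ℕ.<-asym i<j (unprocessed⇒< (next _ _ i<j) u)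

-- Unprocessed pairs are strictly increasing, so R(a,a) always belongs to a unary type, chosen
-- before Stage II.
diagonal-not-pending : ∀ (p : Position n) {a} → ¬ (Unprocessed p a a ⊎ Unprocessed p a a)
diagonal-not-pending p = ℕ.<-irrefl refl ∘ unprocessed⇒< p ∘ [ (λ u → u) , (λ u → u) ]′

-- This allows `φ` to be evaluated at a settled pair from settled atoms alone: the remaining binary
-- instances lie on the diagonal.
pending-instance : ∀ (p : Position n) {a b} (α : Atom 𝒱 Var) →
                   Pending p (instantiate ⟨ a , b ⟩ α) → Unprocessed p a b ⊎ Unprocessed p b a
pending-instance p (binary R x x) = ⊥-elim ∘ diagonal-not-pending p
pending-instance p (binary R x y) = λ u → u
pending-instance p (binary R y x) = Sum.swap
pending-instance p (binary R y y) = ⊥-elim ∘ diagonal-not-pending p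

-- Splicing two structures along the pending atoms.

_≗_on_ : (A B : Structure 𝒱 (Fin n)) → (Atom 𝒱 (Fin n) → Set) → Set
A ≗ B on P = ∀ α → P α → A α ≡ B α

module _ (p : Position n) (A B : Structure 𝒱 (Fin n)) where

  splice : Structure 𝒱 (Fin n)
  splice α = if does (pending? p α) then A α else B α

  splice-pending : splice ≗ A on Pending p
  splice-pending α pend with pending? p α
  ... | yes _ = refl
  ... | no ¬pend = contradiction pend ¬pend

  splice-settled : splice ≗ B on (¬_ ∘ Pending p)
  splice-settled α ¬pend with pending? p α
  ... | yes pend = contradiction pend ¬pend
  ... | no _ = refl

-- The literals of a context in which every element has a unary type.

module _ (Γ : ScottSentence 𝒱) (n : ℕ) where
  open ScottSentence Γ
  open Compilation Γ n
  open Compilation.Context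

  binaryLiterals : List (BinaryType 𝒱 × Fin n × Fin n) → List (Literal 𝒱 (Fin n))
  binaryLiterals = concatMap λ (π , ℓ , t) → π ⟨ ℓ , t ⟩₂

  module _ {A : Structure 𝒱 (Fin n)} where

    -- For a full context `inject≤` is the identity only propositionally; this lemma and
    -- `⊨conj⁻-unary` transport along that equality, so that later arguments can use `ℓ` itself.
    ⊨conj⁺ : ∀ (θ : Context n) → (∀ ℓ → A ⊨ᶜ (type θ ℓ ⟨ ℓ ⟩₁)) →
             A ⊨ᶜ binaryLiterals (binaryTypes θ) → A ⊨ᶜ conj θ
    ⊨conj⁺ (context n≤n τs πs) Aτ = All.++⁺ (All.concat⁺ (All.map⁺ (All.tabulate⁺ λ ℓ →
      subst (λ e → A ⊨ᶜ (lookup τs ℓ ⟨ e ⟩₁)) (sym (Fin.inject≤-refl ℓ n≤n)) (Aτ ℓ))))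

    ⊨conj⁻-unary : ∀ (θ : Context n) → A ⊨ᶜ conj θ → ∀ ℓ → A ⊨ᶜ (type θ ℓ ⟨ ℓ ⟩₁)
    ⊨conj⁻-unary (context n≤n τs πs) Aθ ℓ =
      subst (λ e → A ⊨ᶜ (lookup τs ℓ ⟨ e ⟩₁)) (Fin.inject≤-refl ℓ n≤n)
        (All.tabulate⁻ (All.map⁻ (All.concat⁻
          {xss = map (λ ℓ → lookup τs ℓ ⟨ inject≤ ℓ n≤n ⟩₁) (allFin n)} (All.++⁻ˡ _ Aθ))) ℓ)

    ⊨conj⁻-binary : ∀ (θ : Context n) → A ⊨ᶜ conj θ → A ⊨ᶜ binaryLiterals (binaryTypes θ)
    ⊨conj⁻-binary (context n≤n τs πs) =
      All.++⁻ʳ (concatMap (λ ℓ → lookup τs ℓ ⟨ inject≤ ℓ n≤n ⟩₁) (allFin n))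

    ⊨addBinary⁺ : ∀ (θ : Context n) π i j → A ⊨ᶜ conj θ → A ⊨ᶜ (π ⟨ i , j ⟩₂) →
                  A ⊨ᶜ conj (addBinary θ π i j)
    ⊨addBinary⁺ θ π i j Aθ Aπ = ⊨conj⁺ (addBinary θ π i j) (⊨conj⁻-unary θ Aθ)
      (All.++⁺ Aπ (⊨conj⁻-binary θ Aθ))

    ⊨addBinary⁻ : ∀ (θ : Context n) π i j → A ⊨ᶜ conj (addBinary θ π i j) →
                  A ⊨ᶜ conj θ × A ⊨ᶜ (π ⟨ i , j ⟩₂)
    ⊨addBinary⁻ θ π i j Aθπ =
      ⊨conj⁺ θ (⊨conj⁻-unary (addBinary θ π i j) Aθπ) (All.++⁻ʳ (π ⟨ i , j ⟩₂) Aπs) ,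
      All.++⁻ˡ (π ⟨ i , j ⟩₂) Aπs
      where Aπs = ⊨conj⁻-binary (addBinary θ π i j) Aθπ

  -- The meaning of Stage II circuits.

  Completable : Position n → Context n → Structure 𝒱 (Fin n) → Set
  Completable p θ ω = ∃ λ A → A ⊨ᵍ Γ × A ⊨ᶜ conj θ × A ≗ ω on Pending p

  module _ {i j : Fin n} {i<j : i <ᶠ j} (r : Terminates (next i j i<j)) (θ : Context n) where

    private
      extendableBy? : ∀ π → Dec (Extendable (addBinary θ π i j))
      extendableBy? π = extendable? (addBinary θ π i j)

      candidates : List (BinaryType 𝒱)
      candidates = filter (𝓑? Γ (type θ i) (type θ j)) (allBinaryTypes 𝒱)

      -- A copy of the local `node` of `Stage-II′`, definitionally equal to it, so that the list of
      -- children can be named.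
      branch : BinaryType 𝒱 → Circuit 𝒱 (Fin n)
      branch π = And (And (map lit (π ⟨ i , j ⟩₂)) ∷ Stage-II′ r (addBinary θ π i j) ∷ [])

      branches : List (Circuit 𝒱 (Fin n))
      branches = map branch (filter extendableBy? candidates)

      branch⁻ : ∀ {ω} π → ω ⊩ branch π →
                ω ⊨ᶜ (π ⟨ i , j ⟩₂) × ω ⊩ Stage-II′ r (addBinary θ π i j)
      branch⁻ π (⋀ (ω⊩π ∷ ω⊩next ∷ [])) = Equivalence.to (⊩And-lit⇔⊨ᶜ (π ⟨ i , j ⟩₂)) ω⊩π , ω⊩next

    ⊩step⁻ : ∀ {ω} → ω ⊩ Stage-II′ (step {i<j = i<j} r) θ → ∃ λ π →
             Extendable (addBinary θ π i j) ×
             ω ⊨ᶜ (π ⟨ i , j ⟩₂) × ω ⊩ Stage-II′ r (addBinary θ π i j)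
    ⊩step⁻ ω⊩ =
      let π , π∈ , ω⊩branch = find (Any.map⁻ {f = branch} {xs = filter extendableBy? candidates}
                                             (Equivalence.to (⊩Or⇔Any branches) ω⊩))
      in π , proj₂ (∈-filter⁻ extendableBy? {xs = candidates} π∈) , branch⁻ π ω⊩branch

    ⊩step⁺ : ∀ {ω} π → 𝓑 Γ (type θ i) (type θ j) π → Extendable (addBinary θ π i j) →
             ω ⊨ᶜ (π ⟨ i , j ⟩₂) → ω ⊩ Stage-II′ r (addBinary θ π i j) →
             ω ⊩ Stage-II′ (step {i<j = i<j} r) θ
    ⊩step⁺ π π∈𝓑 ext ωπ ω⊩next = Equivalence.from (⊩Or⇔Any branches)
      (Any.map⁺ {f = branch} {xs = filter extendableBy? candidates} (lose
        (∈-filter⁺ extendableBy? {xs = candidates}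
          (∈-filter⁺ (𝓑? Γ (type θ i) (type θ j)) {xs = allBinaryTypes 𝒱} (∈-allBinaryTypes π) π∈𝓑)
          ext)
        (⋀ (Equivalence.from (⊩And-lit⇔⊨ᶜ (π ⟨ i , j ⟩₂)) ωπ ∷ ω⊩next ∷ []))))

  -- At the end of the recursion nothing is pending, so any model granted by the last extendability
  -- test will do. On the way back, the binary type of the branch taken fixes the atoms of (i,j)
  -- alike in that model and in `ω`.
  ⊩⇒Completable : ∀ {p ω} (r : Terminates p) (θ : Context n) → Extendable θ →
                  ω ⊩ Stage-II′ r θ → Completable p θ ω
  ⊩⇒Completable stop θ (A , AΓ , Aθ) _ =
    A , AΓ , Aθ , λ { (binary _ _ _) (inj₁ ()) ; (binary _ _ _) (inj₂ ()) }
  ⊩⇒Completable {ω = ω} (step {i} {j} {i<j} r) θ _ ω⊩ =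
    let π , ext , ωπ , ω⊩next = ⊩step⁻ {i} {j} {i<j} r θ ω⊩
        A , AΓ , Aθπ , A≗ω    = ⊩⇒Completable r (addBinary θ π i j) ext ω⊩next
        Aθ , Aπ               = ⊨addBinary⁻ θ π i j Aθπ
    in A , AΓ , Aθ , pending-agree A π Aπ ωπ A≗ω
    where
    pending-agree : ∀ A (π : BinaryType 𝒱) → A ⊨ᶜ (π ⟨ i , j ⟩₂) → ω ⊨ᶜ (π ⟨ i , j ⟩₂) →
                    A ≗ ω on Pending (next i j i<j) → A ≗ ω on Pending (pair i j i<j)
    pending-agree A π Aπ ωπ A≗ω α pend with pending-next⁻ i<j α pend
    ... | inj₁ pend′           = A≗ω α pend′
    ... | inj₂ (R , inj₁ refl) = trans (proj₁ (⊨₂⁻ π Aπ) R) (sym (proj₁ (⊨₂⁻ π ωπ) R))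
    ... | inj₂ (R , inj₂ refl) = trans (proj₂ (⊨₂⁻ π Aπ) R) (sym (proj₂ (⊨₂⁻ π ωπ) R))

  -- The branch to follow is given by the type of (i,j) in `ω`. The completing model `A` realizes
  -- it, because the pair is pending; hence the type lies in `𝓑`, and `A` itself passes the
  -- extendability test at every level.
  Completable⇒⊩ : ∀ {p ω} (r : Terminates p) (θ : Context n) →
                  Completable p θ ω → ω ⊩ Stage-II′ r θ
  Completable⇒⊩ stop θ _ = ⊤
  Completable⇒⊩ {ω = ω} (step {i} {j} {i<j} r) θ (A , AΓ , Aθ , A≗ω) =
    ⊩step⁺ {i} {j} {i<j} r θ π
      (realized⇒𝓑 Γ A (type θ i) (type θ j) π AΓ (⊨conj⁻-unary θ Aθ i) (⊨conj⁻-unary θ Aθ j) Aπ)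
      (A , AΓ , Aθπ)
      (⊨-binaryTypeOf ω ω (λ _ → refl) (λ _ → refl))
      (Completable⇒⊩ r (addBinary θ π i j) (A , AΓ , Aθπ , λ α → A≗ω α ∘ pending-next⁺ i<j α))
    where
    π : BinaryType 𝒱
    π = binaryTypeOf ω i j

    Aπ : A ⊨ᶜ (π ⟨ i , j ⟩₂)
    Aπ = ⊨-binaryTypeOf ω A (λ R → A≗ω (binary R i j) (inj₁ (here-unprocessed i<j)))
                            (λ R → A≗ω (binary R j i) (inj₂ (here-unprocessed i<j)))

    Aθπ : A ⊨ᶜ conj (addBinary θ π i j)
    Aθπ = ⊨addBinary⁺ θ π i j Aθ Aπ

  -- What the contexts reached by the algorithm fix.

  -- The invariant of the calls: a context decides every settled atom and says nothing about pending
  -- ones. `determined` turns truth of a settled atom in one model of the context into entailment;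
  -- `local` keeps the context true when pending atoms are overwritten.
  record Settles (p : Position n) (θ : Context n) : Set where
    field
      determined : ∀ {A B} → A ⊨ᶜ conj θ → B ⊨ᶜ conj θ → A ≗ B on (¬_ ∘ Pending p)
      local      : ∀ {A B} → A ≗ B on (¬_ ∘ Pending p) → A ⊨ᶜ conj θ → B ⊨ᶜ conj θ

  open Settles

  unary-settled : ∀ (p : Position n) (A B : Structure 𝒱 (Fin n)) (τ : UnaryType 𝒱) {a} →
                  A ≗ B on (¬_ ∘ Pending p) →
                  A ⊨ᶜ (τ ⟨ a ⟩₁) → B ⊨ᶜ (τ ⟨ a ⟩₁)
  unary-settled p A B τ {a} A≗B Aτ = ⊨₁⁺ τ
    (λ P → trans (sym (A≗B (unary P a) λ ())) (proj₁ (⊨₁⁻ τ Aτ) P))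
    (λ R → trans (sym (A≗B (binary R a a) (diagonal-not-pending p))) (proj₂ (⊨₁⁻ τ Aτ) R))

  Stage-I-binaryTypes : ∀ {k} {θ : Context k} → Stage-I-Call θ → binaryTypes θ ≡ []
  Stage-I-binaryTypes initial                            = refl
  Stage-I-binaryTypes (recurse {θ = context _ _ _} _ c _ _) = Stage-I-binaryTypes c

  -- With `k` positive the call is not the initial one, so it was made only after its context passed
  -- the test.
  Stage-I-extendable : ∀ {k} .{{_ : NonZero k}} {θ : Context k} → Stage-I-Call θ → Extendable θ
  Stage-I-extendable (recurse _ _ _ ext) = ext

  -- Before the first pair is processed, every R(a,b) with distinct arguments is pending in one of
  -- the two orders. The settled atoms are thus the unary and diagonal ones, which are precisely the
  -- atoms of the unary types.
  first-settles : ∀ {θ : Context n} → binaryTypes θ ≡ [] → Settles (first n) θ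
  first-settles {θ} πs≡[] .determined {A} {B} Aθ Bθ = go
    where
    go : A ≗ B on (¬_ ∘ Pending (first n))
    go (unary P a) _ = trans (proj₁ (⊨₁⁻ (type θ a) (⊨conj⁻-unary θ Aθ a)) P)
      (sym (proj₁ (⊨₁⁻ (type θ a) (⊨conj⁻-unary θ Bθ a)) P))
    go (binary R a b) ¬pend with Fin.<-cmp a b
    ... | tri< a<b _ _ = contradiction (inj₁ (first-unprocessed a<b)) ¬pend
    ... | tri> _ _ b<a = contradiction (inj₂ (first-unprocessed b<a)) ¬pend
    ... | tri≈ _ refl _ = trans (proj₂ (⊨₁⁻ (type θ a) (⊨conj⁻-unary θ Aθ a)) R)
      (sym (proj₂ (⊨₁⁻ (type θ a) (⊨conj⁻-unary θ Bθ a)) R))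
  first-settles {θ} πs≡[] .local {A} {B} A≗B Aθ = ⊨conj⁺ θ
    (λ ℓ → unary-settled (first n) A B (type θ ℓ) A≗B (⊨conj⁻-unary θ Aθ ℓ))
    (subst (λ πs → B ⊨ᶜ binaryLiterals πs) (sym πs≡[]) [])

  -- The atoms that stop being pending are those between `i` and `j`, and they are exactly what the
  -- new conjunct `π` fixes.
  next-settles : ∀ {i j i<j π θ} → Settles (pair i j i<j) θ →
                 Settles (next i j i<j) (addBinary θ π i j)
  next-settles {i} {j} {i<j} {π} {θ} s .determined {A} {B} Aθπ Bθπ α ¬pend
    with ⊨addBinary⁻ θ π i j Aθπ | ⊨addBinary⁻ θ π i j Bθπ | pending? (pair i j i<j) α
  ... | Aθ , _  | Bθ , _  | no ¬pend′ = s .determined Aθ Bθ α ¬pend′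
  ... | Aθ , Aπ | Bθ , Bπ | yes pend′ with pending-next⁻ i<j α pend′
  ...   | inj₁ pend            = contradiction pend ¬pend
  ...   | inj₂ (R , inj₁ refl) = trans (proj₁ (⊨₂⁻ π Aπ) R) (sym (proj₁ (⊨₂⁻ π Bπ) R))
  ...   | inj₂ (R , inj₂ refl) = trans (proj₂ (⊨₂⁻ π Aπ) R) (sym (proj₂ (⊨₂⁻ π Bπ) R))
  next-settles {i} {j} {i<j} {π} {θ} s .local {A} {B} A≗B Aθπ with ⊨addBinary⁻ θ π i j Aθπ
  ... | Aθ , Aπ = ⊨addBinary⁺ θ π i j
    (s .local (λ α ¬pend → A≗B α (¬pend ∘ pending-next⁺ i<j α)) Aθ)
    (⊨₂⁺ π
      (λ R → trans (sym (A≗B (binary R i j) (here-not-pending-next i<j))) (proj₁ (⊨₂⁻ π Aπ) R))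
      (λ R → trans (sym (A≗B (binary R j i) (here-not-pending-next i<j ∘ Sum.swap)))
                   (proj₂ (⊨₂⁻ π Aπ) R)))

  Stage-II-settles : ∀ {p θ} → Stage-II-Call p θ → Settles p θ
  Stage-II-settles (initial c)     = first-settles (Stage-I-binaryTypes c)
  Stage-II-settles (recurse c _ _) = next-settles (Stage-II-settles c)

  Stage-II-extendable : .{{_ : NonZero n}} → ∀ {p θ} → Stage-II-Call p θ → Extendable θ
  Stage-II-extendable (initial c)       = Stage-I-extendable c
  Stage-II-extendable (recurse _ _ ext) = ext

  -- Using equality of satisfaction states.

  lookup-S : ∀ θ ℓ k → lookup (lookup (S θ) ℓ) k ≡
             does (Fin.any? λ t → entails? θ (β k at[ ℓ , t ]))
  lookup-S θ ℓ k = trans (cong (λ row → lookup row k) (lookup∘tabulate _ ℓ)) (lookup∘tabulate _ k)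

  -- The matrix records only that some entailed witness exists, so the element obtained for `θ′` may
  -- differ from the one for `θ`.
  S-entails : ∀ {θ θ′ ℓ k} → S θ ≡ S θ′ → (∃ λ t → Entails θ (β k at[ ℓ , t ])) →
              ∃ λ t → Entails θ′ (β k at[ ℓ , t ])
  S-entails {θ} {θ′} {ℓ} {k} S≡S′ θ⊨β = does-true⁻ (witness? θ′) (begin
    does (witness? θ′)         ≡⟨ lookup-S θ′ ℓ k ⟨
    lookup (lookup (S θ′) ℓ) k ≡⟨ cong (λ s → lookup (lookup s ℓ) k) S≡S′ ⟨
    lookup (lookup (S θ) ℓ) k  ≡⟨ lookup-S θ ℓ k ⟩
    does (witness? θ)          ≡⟨ dec-true (witness? θ) θ⊨β ⟩
    true                       ∎)
    where
    open ≡-Reasoning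

    witness? : ∀ θ → Dec (∃ λ t → Entails θ (β k at[ ℓ , t ]))
    witness? θ = Fin.any? λ t → entails? θ (β k at[ ℓ , t ])

  -- Splicing a model of one context into a model of another.

  module _ {p : Position n} {θ θ′ : Context n} (s : Settles p θ) (s′ : Settles p θ′)
           (S≡S′ : S θ ≡ S θ′)
           (𝓑⊆𝓑′ : ∀ ℓ t → Unprocessed p ℓ t → ∀ {π} →
             𝓑 Γ (type θ ℓ) (type θ t) π → 𝓑 Γ (type θ′ ℓ) (type θ′ t) π)
           {A A′ : Structure 𝒱 (Fin n)}
           (AΓ : A ⊨ᵍ Γ) (Aθ : A ⊨ᶜ conj θ) (A′Γ : A′ ⊨ᵍ Γ) (A′θ′ : A′ ⊨ᶜ conj θ′) where

    private
      B : Structure 𝒱 (Fin n)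
      B = splice p A A′

    splice-⊨conj : B ⊨ᶜ conj θ′
    splice-⊨conj = s′ .local (λ α ¬pend → sym (splice-settled p A A′ α ¬pend)) A′θ′

    -- The type of the pair in `A` is realized by a model of `Γ` and `θ`, so it lies in the `𝓑` of
    -- `θ`, hence in that of `θ′`. Since `B` satisfies `θ′` and gives the pair this same type, that
    -- membership can be applied to `B` itself.
    splice-unprocessed : ∀ {a b} → Unprocessed p a b → B ⊨ φ [ a , b ] × B ⊨ φ [ b , a ]
    splice-unprocessed {a} {b} u =
      𝓑⊆𝓑′ a b u {π} (realized⇒𝓑 Γ A (type θ a) (type θ b) π AΓ
          (⊨conj⁻-unary θ Aθ a) (⊨conj⁻-unary θ Aθ b)
          (⊨-binaryTypeOf A A (λ _ → refl) (λ _ → refl)))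
        (Fin n) B a b
        (All.++⁺ (⊨conj⁻-unary θ′ splice-⊨conj a)
          (All.++⁺ (⊨conj⁻-unary θ′ splice-⊨conj b)
            (⊨-binaryTypeOf A B (λ R → splice-pending p A A′ (binary R a b) (inj₁ u))
                                (λ R → splice-pending p A A′ (binary R b a) (inj₂ u)))))
      where
      π : BinaryType 𝒱
      π = binaryTypeOf A a b

    splice-⊨φ : ∀ a b → B ⊨ φ [ a , b ]
    splice-⊨φ a b with unprocessed? p a b ⊎-dec unprocessed? p b a
    ... | yes (inj₁ u) = proj₁ (splice-unprocessed u)
    ... | yes (inj₂ u) = proj₂ (splice-unprocessed u)
    -- No atom instantiated at this pair is pending, so `B` evaluates `φ` here as `A′` does.
    ... | no ¬u = trans
      (⟦⟧-cong φ λ α → splice-settled p A A′ (instantiate ⟨ a , b ⟩ α) (¬u ∘ pending-instance p α))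
      (proj₁ A′Γ a b)

    splice-⊨β : ∀ k a → ∃ λ b → B (β k at[ a , b ]) ≡ true
    splice-⊨β k a = let b , Aβ = proj₂ AΓ k a in witness b Aβ (pending? p (β k at[ a , b ]))
      where
      witness : ∀ b → A (β k at[ a , b ]) ≡ true → Dec (Pending p (β k at[ a , b ])) →
                ∃ λ b′ → B (β k at[ a , b′ ]) ≡ true
      witness b Aβ (yes pend) = b , trans (splice-pending p A A′ _ pend) Aβ
      -- All models of `θ` agree with `A` on a settled atom, so its truth in `A` is entailment by
      -- `θ`. The equal states supply an atom entailed by `θ′`, and `B` is a model of `θ′`.
      witness b Aβ (no ¬pend) =
        let b′ , θ′⊨β = S-entails {θ} {θ′} {a} {k} S≡S′
              (b , λ A″ A″θ → trans (s .determined A″θ Aθ _ ¬pend) Aβ)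
        in b′ , θ′⊨β B splice-⊨conj

  -- Only one inclusion between the sets `𝓑` is assumed, so that the lemma serves each direction of
  -- the equivalence. The model `A′` may disagree with `ω`: on pending atoms the splice follows `A`.
  Completable-transfer : ∀ {p θ θ′ ω} → Settles p θ → Settles p θ′ → Extendable θ′ → S θ ≡ S θ′ →
    (∀ ℓ t → Unprocessed p ℓ t → ∀ {π} →
      𝓑 Γ (type θ ℓ) (type θ t) π → 𝓑 Γ (type θ′ ℓ) (type θ′ t) π) →
    Completable p θ ω → Completable p θ′ ω
  Completable-transfer {p} s s′ (A′ , A′Γ , A′θ′) S≡S′ 𝓑⊆𝓑′ (A , AΓ , Aθ , A≗ω) =
    splice p A A′ ,
    (splice-⊨φ s s′ S≡S′ 𝓑⊆𝓑′ AΓ Aθ A′Γ A′θ′ , splice-⊨β s s′ S≡S′ 𝓑⊆𝓑′ AΓ Aθ A′Γ A′θ′) ,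
    splice-⊨conj s s′ S≡S′ 𝓑⊆𝓑′ AΓ Aθ A′Γ A′θ′ ,
    λ α pend → trans (splice-pending p A A′ α pend) (A≗ω α pend)

-- Equivalence of the two circuits, by transferring completions both ways.

proposition21 : (𝒱 : Vocabulary) (Γ : ScottSentence 𝒱) (n : ℕ) .{{_ : NonZero n}} →
    let open Compilation Γ n in
    (p : Position n) (θ θ′ : Context n) →
    Stage-II-Call p θ → Stage-II-Call p θ′ →
    S θ ≡ S θ′ →
    (∀ ℓ t → Unprocessed p ℓ t → 𝓑 Γ (type θ ℓ) (type θ t) ≐ 𝓑 Γ (type θ′ ℓ) (type θ′ t)) →
    Equivalent (Stage-II p θ) (Stage-II p θ′)
proposition21 𝒱 Γ n p θ θ′ c c′ S≡S′ 𝓑≐𝓑′ ω = mk⇔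
  (Completable⇒⊩ Γ n (terminates p) θ′
    ∘ Completable-transfer Γ n {p} {θ} {θ′} {ω} s s′ ext′ S≡S′
        (λ ℓ t u {π} → proj₁ (𝓑≐𝓑′ ℓ t u) {π})
    ∘ ⊩⇒Completable Γ n (terminates p) θ ext)
  (Completable⇒⊩ Γ n (terminates p) θ
    ∘ Completable-transfer Γ n {p} {θ′} {θ} {ω} s′ s ext (sym S≡S′)
        (λ ℓ t u {π} → proj₂ (𝓑≐𝓑′ ℓ t u) {π})
    ∘ ⊩⇒Completable Γ n (terminates p) θ′ ext′)
  where
  s    = Stage-II-settles Γ n c
  s′   = Stage-II-settles Γ n c′
  ext  = Stage-II-extendable Γ n c
  ext′ = Stage-II-extendable Γ n c′
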